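{- Let $G$ be a graph, $G'$ an induced subgraph of $G$, and $s,t,c$ positive integers. If there exists a list $\mathcal{F}$ of $s$-boosted balanced separators of $G'$ with cores originating in $G$ such that $|\mathcal{F}|\geq 80\cdot s\cdot t\cdot c$ and no vertex of $G'$ belongs to more than $c$ sets of $\mathcal{F}$, then $G$ contains an induced $S_{t,t,t}$.
   Context: Graphs are finite and simple. $S_{t,t,t}$ is the tree with exactly three leaves, each at distance $t$ from the unique vertex of degree $3$. $N_G[X]$ is the set of vertices in $X$ or having a neighbor in $X$ in $G$, and $N_G^{G'}[X]=N_G[X]\cap V(G')$. A list is an ordered multiset of vertex subsets; sizes and memberships are counted with multiplicity. Let $G'$ be a nonempty induced subgraph of $G$ and $s$ a positive integer. A set $Y\subseteq V(G')$ is an $s$-boosted balanced separator for $G'$ with a core $X$ originating in $G$ if $X\subseteq V(G)$, $Y=N_G^{G'}[X]$, $|X|\leq s$, and no connected component of $G'-Y$ has more than $\frac{|C|}{16s^2}$ vertices, where $C$ is a largest connected component of $G'$. -}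

module Defs where

open import Data.Fin using (Fin; toℕ)
import Data.Fin.Properties as Fin
open import Data.Fin.Subset using (Subset; _∈_; _⊆_; _∩_; _─_; ∣_∣; Nonempty)
open import Data.Fin.Subset.Properties using (_∈?_)
open import Data.List using (List; length; filter)
open import Data.Nat using (ℕ; suc; _*_; _^_; _≤_)
import Data.Nat.Properties as ℕ
open import Data.Product using (Σ; ∃; _×_; _,_)
open import Data.Sum using (inj₁; inj₂)
open import Data.Vec using (tabulate)
open import Function.Bundles using (_↣_; _⇔_; Injection)
open import Level using (0ℓ)
open import Relation.Binary.Core using (Rel)
open import Relation.Binary.Definitions using (Symmetric; Decidable)
open import Relation.Binary.Construct.Closure.ReflexiveTransitive using (Star)
open import Relation.Binary.Construct.Closure.Symmetric using (SymClosure; fwd; bwd; symmetric)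
open import Relation.Binary.PropositionalEquality using (_≡_; refl; sym)
open import Relation.Nullary using (¬_; no; does; _×-dec_; _⊎-dec_)
open import Relation.Nullary.Decidable using (map′)

-- A finite graph on n vertices is a Graph (Fin n).  Decidability of adjacency
-- is automatic classically.
record Graph (V : Set) : Set₁ where
  field
    Adj       : Rel V 0ℓ
    adj?      : Decidable Adj
    symm      : Symmetric Adj
    loopless  : ∀ {v} → ¬ Adj v v

open Graph public

-- H is isomorphic to an induced subgraph of G.
_IsInducedIn_ : {W V : Set} → Graph W → Graph V → Set
_IsInducedIn_ {W} {V} H G =
  Σ (W ↣ V) λ f → ∀ a b → Adj H a b ⇔ Adj G (Injection.to f a) (Injection.to f b)

-- S_{t,t,t}: leg i k is the vertex at distance 1 + toℕ k from the centre on
-- the i-th of the three legs, so for t ≥ 1 the leaves are the last vertices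
-- of the legs, at distance t.
data SVertex (t : ℕ) : Set where
  centre : SVertex t
  leg    : Fin 3 → Fin t → SVertex t

data SEdge {t : ℕ} : Rel (SVertex t) 0ℓ where
  hub  : ∀ {i k} → toℕ k ≡ 0 → SEdge centre (leg i k)
  next : ∀ {i k l} → toℕ l ≡ suc (toℕ k) → SEdge (leg i k) (leg i l)

sEdge? : ∀ {t} → Decidable (SEdge {t})
sEdge? centre    centre    = no λ ()
sEdge? centre    (leg i k) = map′ hub (λ { (hub e) → e }) (toℕ k ℕ.≟ 0)
sEdge? (leg i k) centre    = no λ ()
sEdge? (leg i k) (leg j l) =
  map′ (λ { (refl , e) → next e }) (λ { (next e) → refl , e })
       (i Fin.≟ j ×-dec toℕ l ℕ.≟ suc (toℕ k))

sEdge-irrefl : ∀ {t} {v : SVertex t} → ¬ SEdge v v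
sEdge-irrefl (next e) = ℕ.1+n≢n (sym e)

S : (t : ℕ) → Graph (SVertex t)
S t = record
  { Adj      = SymClosure SEdge
  ; adj?     = λ u v → map′ (λ { (inj₁ e) → fwd e ; (inj₂ e) → bwd e })
                            (λ { (fwd e) → inj₁ e ; (bwd e) → inj₂ e })
                            (sEdge? u v ⊎-dec sEdge? v u)
  ; symm     = symmetric SEdge
  ; loopless = λ { (fwd e) → sEdge-irrefl e ; (bwd e) → sEdge-irrefl e }
  }

-- Induced subgraphs of a fixed G are given by their vertex sets; InducedAdj G W
-- is the adjacency of G[W].
module _ {n : ℕ} (G : Graph (Fin n)) where

  InducedAdj : Subset n → Rel (Fin n) 0ℓ
  InducedAdj W u v = u ∈ W × v ∈ W × Adj G u v

  IsConnected : Subset n → Set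
  IsConnected W = ∀ {u v} → u ∈ W → v ∈ W → Star (InducedAdj W) u v

  -- C is (the vertex set of) a connected component of G[W].
  record IsComponent (W C : Subset n) : Set where
    field
      nonempty  : Nonempty C
      within    : C ⊆ W
      connected : IsConnected C
      maximal   : ∀ D → D ⊆ W → IsConnected D → C ⊆ D → D ⊆ C

  IsLargestComponent : (W C : Subset n) → Set
  IsLargestComponent W C =
    IsComponent W C × (∀ D → IsComponent W D → ∣ D ∣ ≤ ∣ C ∣)

  N[_] : Subset n → Subset n
  N[ X ] = tabulate λ v →
    does (v ∈? X ⊎-dec Fin.any? λ u → u ∈? X ×-dec adj? G v u)

  -- Y is an s-boosted balanced separator for G[V′] with core X originating in G.
  -- C may be any largest component, since only its size matters; its presence
  -- also forces V′ to be nonempty.  The bound |D| ≤ |C| / (16 s²) is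
  -- stated with the denominator cleared.
  record IsBoostedSeparatorWithCore (V′ : Subset n) (s : ℕ) (Y X : Subset n) : Set where
    field
      Y≡N       : Y ≡ N[ X ] ∩ V′
      core-size : ∣ X ∣ ≤ s
      C         : Subset n
      C-largest : IsLargestComponent V′ C
      balanced  : ∀ D → IsComponent (V′ ─ Y) D → 16 * s ^ 2 * ∣ D ∣ ≤ ∣ C ∣

  IsBoostedSeparator : (V′ : Subset n) (s : ℕ) → Subset n → Set
  IsBoostedSeparator V′ s Y = ∃ (IsBoostedSeparatorWithCore V′ s Y)

-- The number of entries of F containing v, counted with multiplicity.
occurrences : ∀ {n} → Fin n → List (Subset n) → ℕ
occurrences v F = length (filter (v ∈?_) F)

{-# OPTIONS --safe #-}

-- Fix a largest component C, a root r ∈ C, and for each u ∈ C a shortest path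
-- P_u in C from u to r.  A separator Y ∈ F cuts C into small pieces, so for
-- almost all u it meets P_u; colour u by a core vertex x that equals or is
-- adjacent to the first vertex of Y on P_u.  The part of P_u up to that vertex
-- is a candidate for a leg of a claw centred at x.
--
-- For a pair u, v the two candidate legs can only touch when u and v lie in the
-- same component of G′ − Y or Y contains one of four vertices determined by
-- u and v alone: because P_u and P_v are shortest paths, the first contact of
-- P_u with P_v and the first contact of P_v with P_u are within distance two
-- of each other along the paths.  Requiring also that Y avoids the first t
-- vertices of P_u, each pair has t + 4 obstacles, each lying in at most c
-- members of F, so some Y has few bad pairs.  On the other hand, if no
-- three vertices of the same colour are pairwise good, then counting triples
-- in each colour class and Cauchy–Schwarz over the s colours show that at least
-- |C|² / (3s) ordered pairs are bad.

module Submission where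

open import Data.Nat
  using (ℕ; zero; suc; pred; _+_; _*_; _^_; _∸_; _≤_; _<_; _≥_; z≤n; s≤s; NonZero; >-nonZero; >-nonZero⁻¹)
open import Data.Nat.Properties as ℕ hiding (_≟_)
open import Algebra.Properties.Semiring.Sum +-*-semiring
  using (sum; sum-cong-≗; ∑-distrib-+; ∑-comm; *-distribˡ-sum; *-distribʳ-sum)
open import Data.Bool using (if_then_else_; true; false)
open import Data.Fin using (Fin; zero; suc; toℕ; fromℕ<; inject≤; splitAt; _↑ˡ_; _↑ʳ_)
open import Data.Fin.Properties
  using (_≟_; any?; toℕ-injective; toℕ<n; toℕ-fromℕ<; splitAt-↑ˡ; splitAt-↑ʳ; inject≤-injective)
open import Data.Fin.Subset
  using (Subset; inside; outside; _∈_; _∉_; _⊆_; _∪_; _─_; ⁅_⁆; ⊥; ∣_∣; Nonempty)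
open import Data.Fin.Subset.Properties
open import Data.List using (List; []; _∷_; length; lookup)
open import Data.List.Membership.Propositional.Properties using (∈-lookup)
open import Data.List.Relation.Unary.All as All using (All; []; _∷_)
open import Data.Nat.Tactic.RingSolver using (solve-∀)
open import Data.Product using (∃; Σ; _×_; _,_; proj₁; proj₂)
open import Data.Sum using (_⊎_; inj₁; inj₂; [_,_]′)
open import Data.Vec using ([]; _∷_; here; there)
open import Data.Vec.Properties using (lookup∘tabulate; []=⇒lookup; lookup⇒[]=)
open import Function using (_∘_; _⇔_; Equivalence; id; mk⇔; mk↣)
open import Relation.Binary.Construct.Closure.ReflexiveTransitive as Star using (Star; ε; _◅_; _◅◅_)
open import Relation.Binary.Construct.Closure.Symmetric using (fwd; bwd)
open import Relation.Binary.PropositionalEquality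
open import Relation.Nullary using (¬_; Dec; yes; no; does; contradiction; ¬?; _×-dec_; _⊎-dec_)
open import Relation.Nullary.Decidable using (dec-true; decidable-stable)
open import Defs

-- Finite sums of natural numbers

sum-mono : ∀ {n} {f g : Fin n → ℕ} → (∀ i → f i ≤ g i) → sum f ≤ sum g
sum-mono {zero}  f≤g = z≤n
sum-mono {suc n} f≤g = +-mono-≤ (f≤g zero) (sum-mono (f≤g ∘ suc))

sum-const : ∀ n b → sum {n} (λ _ → b) ≡ n * b
sum-const zero    b = refl
sum-const (suc n) b = cong (b +_) (sum-const n b)

sum-≤ : ∀ {n} {f : Fin n → ℕ} b → (∀ i → f i ≤ b) → sum f ≤ n * b
sum-≤ {n} b f≤b = ≤-trans (sum-mono f≤b) (≤-reflexive (sum-const n b))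

term≤sum : ∀ {n} (f : Fin n → ℕ) i → f i ≤ sum f
term≤sum f zero    = m≤m+n _ _
term≤sum f (suc i) = ≤-trans (term≤sum (f ∘ suc) i) (m≤n+m _ (f zero))

sum²-cong : ∀ {m n} {f g : Fin m → Fin n → ℕ} → (∀ i j → f i j ≡ g i j) →
            sum (λ i → sum (f i)) ≡ sum (λ i → sum (g i))
sum²-cong f≗g = sum-cong-≗ λ i → sum-cong-≗ (f≗g i)

sum²-distrib-+ : ∀ {m n} (f g : Fin m → Fin n → ℕ) →
  sum (λ i → sum λ j → f i j + g i j) ≡ sum (λ i → sum (f i)) + sum (λ i → sum (g i))
sum²-distrib-+ f g =
  trans (sum-cong-≗ λ i → ∑-distrib-+ (f i) (g i)) (∑-distrib-+ (sum ∘ f) (sum ∘ g))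

sum-*-sum : ∀ {m n} (f : Fin m → ℕ) (g : Fin n → ℕ) →
            sum (λ i → sum λ j → f i * g j) ≡ sum f * sum g
sum-*-sum f g = begin
  sum (λ i → sum λ j → f i * g j)  ≡⟨ sum-cong-≗ (λ i → *-distribˡ-sum (f i) g) ⟨
  sum (λ i → f i * sum g)          ≡⟨ *-distribʳ-sum (sum g) f ⟨
  sum f * sum g                    ∎
  where open ≡-Reasoning

-- Indicators, the Cauchy-Schwarz inequality and triple counts

𝟙 : ∀ {p} {P : Set p} → Dec P → ℕ
𝟙 d = if does d then 1 else 0

𝟙-yes : ∀ {p} {P : Set p} (d : Dec P) → P → 𝟙 d ≡ 1
𝟙-yes (yes _) p = refl
𝟙-yes (no ¬p) p = contradiction p ¬p

𝟙≡0⇒¬ : ∀ {p} {P : Set p} (d : Dec P) → 𝟙 d ≡ 0 → ¬ P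
𝟙≡0⇒¬ d eq p with () ← trans (sym eq) (𝟙-yes d p)

sum-𝟙-≟ : ∀ {n} (i : Fin n) → sum (λ j → 𝟙 (i ≟ j)) ≡ 1
sum-𝟙-≟ {suc n} zero    = cong suc (trans (sum-const n 0) (*-zeroʳ n))
sum-𝟙-≟ (suc i) = sum-𝟙-≟ i

2ab≤a²+b² : ∀ a b → 2 * (a * b) ≤ a * a + b * b
2ab≤a²+b² a b with ≤-total a b
... | inj₁ a≤b with d , refl ← m≤n⇒∃[o]m+o≡n a≤b =
  ≤-trans (m≤m+n _ (d * d)) (≤-reflexive (lem a d))
  where
  lem : ∀ a d → 2 * (a * (a + d)) + d * d ≡ a * a + (a + d) * (a + d)
  lem = solve-∀
... | inj₂ b≤a with d , refl ← m≤n⇒∃[o]m+o≡n b≤a =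
  ≤-trans (m≤m+n _ (d * d)) (≤-reflexive (lem b d))
  where
  lem : ∀ b d → 2 * ((b + d) * b) + d * d ≡ (b + d) * (b + d) + b * b
  lem = solve-∀

-- Twice the product is a double sum, bounded termwise by `2ab≤a²+b²`; each square then occurs n
-- times through either index.
cauchy-schwarz : ∀ {n} (f : Fin n → ℕ) → sum f * sum f ≤ n * sum (λ i → f i * f i)
cauchy-schwarz {n} f = *-cancelˡ-≤ 2 (begin
  2 * (sum f * sum f)                              ≡⟨ cong (2 *_) (sum-*-sum f f) ⟨
  2 * sum (λ i → sum λ j → f i * f j)              ≡⟨ *-distribˡ-sum 2 (λ i → sum λ j → f i * f j) ⟩
  sum (λ i → 2 * sum λ j → f i * f j)              ≡⟨ sum-cong-≗ (λ i → *-distribˡ-sum 2 (λ j → f i * f j)) ⟩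
  sum (λ i → sum λ j → 2 * (f i * f j))            ≤⟨ sum-mono (λ i → sum-mono λ j → 2ab≤a²+b² (f i) (f j)) ⟩
  sum (λ i → sum λ j → f i * f i + f j * f j)      ≡⟨ sum²-distrib-+ (λ i j → f i * f i) (λ i j → f j * f j) ⟩
  sum (λ i → sum {n} λ j → f i * f i) + sum {n} (λ i → Q)
                                                   ≡⟨ cong₂ _+_ (sum-cong-≗ λ i → sum-const n (f i * f i)) (sum-const n Q) ⟩
  sum (λ i → n * (f i * f i)) + n * Q              ≡⟨ cong (_+ n * Q) (*-distribˡ-sum n (λ i → f i * f i)) ⟨
  n * Q + n * Q                                    ≡⟨ cong (n * Q +_) (+-identityʳ _) ⟨
  2 * (n * Q)                                      ∎)
  where
  open ≤-Reasoning
  Q = sum λ i → f i * f i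

sum³ : ∀ {n} → (Fin n → Fin n → Fin n → ℕ) → ℕ
sum³ f = sum λ u → sum λ v → sum λ w → f u v w

-- Makes the pairs uv, vw and wu of a triple contribute equally to the count.
sum³-cycle : ∀ {n} (f : Fin n → Fin n → Fin n → ℕ) → sum³ (λ u v w → f v w u) ≡ sum³ f
sum³-cycle f = trans (∑-comm λ u v → sum λ w → f v w u)
                     (sum-cong-≗ λ v → ∑-comm λ u w → f v w u)

-- For the indicator a of a class, the hypothesis says that each ordered triple
-- of the class contains a pair with ρ > 0.
square≤conflicts : ∀ {n} (a : Fin n → ℕ) (ρ : Fin n → Fin n → ℕ) →
  (∀ u v w → a u * a v * a w ≤ a u * a v * a w * (ρ u v + ρ v w + ρ w u)) →
  sum a * sum a ≤ 3 * sum λ u → sum λ v → a u * a v * ρ u v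
square≤conflicts {n} a ρ h with sum a in eq
... | zero  = z≤n
-- The hypothesis summed over all triples is cubic in `sum a`, so one positive factor cancels.
... | suc p = *-cancelʳ-≤ _ _ (suc p) (subst (λ q → q * q * q ≤ 3 * K * q) eq cubic)
  where
  open ≤-Reasoning
  K = sum λ u → sum λ v → a u * a v * ρ u v

  g : Fin n → Fin n → Fin n → ℕ
  g u v w = a u * a v * ρ u v * a w

  expand : ∀ x y z i j k → x * y * z * (i + j + k) ≡ x * y * i * z + y * z * j * x + z * x * k * y
  expand = solve-∀

  sum³-a : sum³ (λ u v w → a u * a v * a w) ≡ sum a * sum a * sum a
  sum³-a = begin-equality
    sum³ (λ u v w → a u * a v * a w)                ≡⟨ sum²-cong (λ u v → sym (*-distribˡ-sum (a u * a v) a)) ⟩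
    sum (λ u → sum λ v → a u * a v * sum a)         ≡⟨ sum-cong-≗ (λ u → sym (*-distribʳ-sum (sum a) λ v → a u * a v)) ⟩
    sum (λ u → sum (λ v → a u * a v) * sum a)       ≡⟨ *-distribʳ-sum (sum a) (λ u → sum λ v → a u * a v) ⟨
    sum (λ u → sum λ v → a u * a v) * sum a         ≡⟨ cong (_* sum a) (sum-*-sum a a) ⟩
    sum a * sum a * sum a                           ∎

  sum³-g : sum³ g ≡ K * sum a
  sum³-g = begin-equality
    sum³ g                                               ≡⟨ sum²-cong (λ u v → sym (*-distribˡ-sum (a u * a v * ρ u v) a)) ⟩
    sum (λ u → sum λ v → a u * a v * ρ u v * sum a)      ≡⟨ sum-cong-≗ (λ u → sym (*-distribʳ-sum (sum a) λ v → a u * a v * ρ u v)) ⟩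
    sum (λ u → sum (λ v → a u * a v * ρ u v) * sum a)    ≡⟨ *-distribʳ-sum (sum a) (λ u → sum λ v → a u * a v * ρ u v) ⟨
    K * sum a                                            ∎

  sum³-+ : ∀ f f′ → sum³ (λ u v w → f u v w + f′ u v w) ≡ sum³ f + sum³ f′
  sum³-+ f f′ = trans (sum-cong-≗ λ u → sum²-distrib-+ (f u) (f′ u))
    (∑-distrib-+ (λ u → sum λ v → sum (f u v)) (λ u → sum λ v → sum (f′ u v)))

  cubic : sum a * sum a * sum a ≤ 3 * K * sum a
  cubic = begin
    sum a * sum a * sum a                                       ≡⟨ sum³-a ⟨
    sum³ (λ u v w → a u * a v * a w)                            ≤⟨ sum-mono (λ u → sum-mono λ v → sum-mono λ w → h u v w) ⟩
    sum³ (λ u v w → a u * a v * a w * (ρ u v + ρ v w + ρ w u))  ≡⟨ sum-cong-≗ (λ u → sum²-cong λ v w → expand (a u) (a v) (a w) (ρ u v) (ρ v w) (ρ w u)) ⟩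
    sum³ (λ u v w → g u v w + g v w u + g w u v)                ≡⟨ sum³-+ (λ u v w → g u v w + g v w u) (λ u v w → g w u v) ⟩
    sum³ (λ u v w → g u v w + g v w u) + sum³ (λ u v w → g w u v)
      ≡⟨ cong₂ _+_ (trans (sum³-+ g λ u v w → g v w u) (cong (sum³ g +_) (sum³-cycle g)))
                   (sym (sum³-cycle λ u v w → g w u v)) ⟩
    sum³ g + sum³ g + sum³ g                                    ≡⟨ cong (λ q → q + q + q) sum³-g ⟩
    K * sum a + K * sum a + K * sum a                           ≡⟨ triple K (sum a) ⟩
    3 * K * sum a                                               ∎
    where
    triple : ∀ k p → k * p + k * p + k * p ≡ 3 * k * p
    triple = solve-∀

-- Monochromatic triples and the number of conflicts

module _ {m s : ℕ} (k : Fin m → Fin s) (ρ : Fin m → Fin m → ℕ) where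

  -- Repetitions are allowed, so the count can run over all ordered triples. As `ρ` may be
  -- asymmetric, only the three cyclic pairs are tested.
  CompatibleTriple : Set
  CompatibleTriple = ∃ λ u → ∃ λ v → ∃ λ w →
    k u ≡ k v × k v ≡ k w × ρ u v ≡ 0 × ρ v w ≡ 0 × ρ w u ≡ 0

  -- Without such a triple, a colour class of size k carries at least k²/3 conflicts, and by
  -- Cauchy-Schwarz the squares of the s class sizes sum to at least m²/s.
  compatibleTriple⊎dense : CompatibleTriple ⊎ m * m ≤ 3 * s * sum λ u → sum λ v → ρ u v
  compatibleTriple⊎dense
    with any? (λ u → any? λ v → any? λ w → k u ≟ k v ×-dec k v ≟ k w ×-dec
               ρ u v ℕ.≟ 0 ×-dec ρ v w ℕ.≟ 0 ×-dec ρ w u ℕ.≟ 0)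
  ... | yes found = inj₁ found
  ... | no  none  = inj₂ dense
    where
    open ≤-Reasoning

    a : Fin s → Fin m → ℕ
    a x u = 𝟙 (k u ≟ x)

    K : Fin s → ℕ
    K x = sum λ u → sum λ v → a x u * a x v * ρ u v

    covered : ∀ x u v w → a x u * a x v * a x w ≤ a x u * a x v * a x w * (ρ u v + ρ v w + ρ w u)
    covered x u v w with k u ≟ x | k v ≟ x | k w ≟ x
    ... | no _ | _ | _ = z≤n
    ... | yes _ | no _ | _ = z≤n
    ... | yes _ | yes _ | no _ = z≤n
    ... | yes refl | yes kv | yes kw with ρ u v + ρ v w + ρ w u in eq
    ...   | suc _ = s≤s z≤n
    ...   | zero = contradiction
      (u , v , w , sym kv , trans kv (sym kw)
         , m+n≡0⇒m≡0 _ (m+n≡0⇒m≡0 (ρ u v + ρ v w) eq)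
         , m+n≡0⇒n≡0 (ρ u v) (m+n≡0⇒m≡0 (ρ u v + ρ v w) eq)
         , m+n≡0⇒n≡0 (ρ u v + ρ v w) eq) none

    a*a≤a : ∀ x u v → a x u * a x v ≤ a x u
    a*a≤a x u v with k u ≟ x | k v ≟ x
    ... | no _  | _     = z≤n
    ... | yes _ | no _  = z≤n
    ... | yes _ | yes _ = ≤-refl

    sum-classes : sum (λ x → sum (a x)) ≡ m
    sum-classes = begin-equality
      sum (λ x → sum (a x))            ≡⟨ ∑-comm a ⟩
      sum (λ u → sum λ x → a x u)      ≡⟨ sum-cong-≗ (λ u → sum-𝟙-≟ (k u)) ⟩
      sum {m} (λ u → 1)                ≡⟨ sum-const m 1 ⟩
      m * 1                            ≡⟨ *-identityʳ m ⟩
      m                                ∎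

    -- Dropping the colour condition on v only adds conflicts, and u has exactly one colour.
    sum-K : sum K ≤ sum λ u → sum λ v → ρ u v
    sum-K = begin
      sum K                                                     ≡⟨ ∑-comm (λ x u → sum λ v → a x u * a x v * ρ u v) ⟩
      sum (λ u → sum λ x → sum λ v → a x u * a x v * ρ u v)     ≡⟨ sum-cong-≗ (λ u → ∑-comm λ x v → a x u * a x v * ρ u v) ⟩
      sum (λ u → sum λ v → sum λ x → a x u * a x v * ρ u v)     ≤⟨ sum-mono (λ u → sum-mono λ v → sum-mono λ x → *-monoˡ-≤ (ρ u v) (a*a≤a x u v)) ⟩
      sum (λ u → sum λ v → sum λ x → a x u * ρ u v)             ≡⟨ sum²-cong (λ u v → *-distribʳ-sum (ρ u v) λ x → a x u) ⟨
      sum (λ u → sum λ v → sum (λ x → a x u) * ρ u v)           ≡⟨ sum²-cong (λ u v → trans (cong (_* ρ u v) (sum-𝟙-≟ (k u))) (*-identityˡ _)) ⟩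
      sum (λ u → sum λ v → ρ u v)                               ∎

    dense : m * m ≤ 3 * s * sum λ u → sum λ v → ρ u v
    dense = begin
      m * m                                        ≡⟨ cong₂ _*_ sum-classes sum-classes ⟨
      sum (λ x → sum (a x)) * sum (λ x → sum (a x)) ≤⟨ cauchy-schwarz (λ x → sum (a x)) ⟩
      s * sum (λ x → sum (a x) * sum (a x))        ≤⟨ *-monoʳ-≤ s (sum-mono λ x → square≤conflicts (a x) ρ (covered x)) ⟩
      s * sum (λ x → 3 * K x)                      ≡⟨ cong (s *_) (*-distribˡ-sum 3 K) ⟨
      s * (3 * sum K)                              ≤⟨ *-monoʳ-≤ s (*-monoʳ-≤ 3 sum-K) ⟩
      s * (3 * R)                                  ≡⟨ assoc3 s R ⟩
      3 * s * R                                    ∎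
      where
      R = sum λ u → sum λ v → ρ u v
      assoc3 : ∀ s r → s * (3 * r) ≡ 3 * s * r
      assoc3 = solve-∀

-- Enumeration of a subset

enum : ∀ {n} (p : Subset n) → Fin ∣ p ∣ → Fin n
enum (inside  ∷ p) zero    = zero
enum (inside  ∷ p) (suc i) = suc (enum p i)
enum (outside ∷ p) i       = suc (enum p i)

enum-∈ : ∀ {n} (p : Subset n) i → enum p i ∈ p
enum-∈ (inside  ∷ p) zero    = here
enum-∈ (inside  ∷ p) (suc i) = there (enum-∈ p i)
enum-∈ (outside ∷ p) i       = there (enum-∈ p i)

enum-surjective : ∀ {n} {p : Subset n} {x} → x ∈ p → ∃ λ i → enum p i ≡ x
enum-surjective {p = inside  ∷ p} here = zero , refl
enum-surjective {p = inside  ∷ p} (there x∈p) with i , refl ← enum-surjective x∈p = suc i , refl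
enum-surjective {p = outside ∷ p} (there x∈p) with i , refl ← enum-surjective x∈p = i , refl

-- `enum` lists p without repetition, so the sum counts the intersection of p and q.
sum-enum-∈≤∣∣ : ∀ {n} (p q : Subset n) → sum (λ i → 𝟙 (enum p i ∈? q)) ≤ ∣ q ∣
sum-enum-∈≤∣∣ []            []            = z≤n
sum-enum-∈≤∣∣ (inside  ∷ p) (inside  ∷ q) = s≤s (sum-enum-∈≤∣∣ p q)
sum-enum-∈≤∣∣ (inside  ∷ p) (outside ∷ q) = sum-enum-∈≤∣∣ p q
sum-enum-∈≤∣∣ (outside ∷ p) (inside  ∷ q) = m≤n⇒m≤1+n (sum-enum-∈≤∣∣ p q)
sum-enum-∈≤∣∣ (outside ∷ p) (outside ∷ q) = sum-enum-∈≤∣∣ p q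

-- Occurrence counts, finite choice and truncated subtraction

occurrences≡sum : ∀ {n} (v : Fin n) (F : List (Subset n)) →
                  occurrences v F ≡ sum λ i → 𝟙 (v ∈? lookup F i)
occurrences≡sum v [] = refl
occurrences≡sum v (Y ∷ F) with does (v ∈? Y)
... | true  = cong suc (occurrences≡sum v F)
... | false = occurrences≡sum v F

-- Lets a claw found at one separator finish the proof, and otherwise collects the counting bound at
-- all of them.
sequence-⊎ : ∀ {n} {A : Set} {P : Fin n → Set} → (∀ i → A ⊎ P i) → A ⊎ (∀ i → P i)
sequence-⊎ {zero}  f = inj₂ λ ()
sequence-⊎ {suc n} f with f zero | sequence-⊎ (f ∘ suc)
... | inj₁ a | _       = inj₁ a
... | inj₂ _ | inj₁ a  = inj₁ a
... | inj₂ p | inj₂ ps = inj₂ λ { zero → p ; (suc i) → ps i }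

-- Legs are numbered backwards along a path; this turns consecutive path positions into consecutive
-- leg positions.
∸-step : ∀ {d k l} → k ≤ d → l ≤ d → d ∸ l ≡ suc (d ∸ k) → k ≡ suc l
∸-step {d} {k} {l} k≤d l≤d e = +-cancelʳ-≡ (d ∸ k) k (suc l) (begin
  k + (d ∸ k)        ≡⟨ m+[n∸m]≡n k≤d ⟩
  d                  ≡⟨ m+[n∸m]≡n l≤d ⟨
  l + (d ∸ l)        ≡⟨ cong (l +_) e ⟩
  l + suc (d ∸ k)    ≡⟨ +-suc l (d ∸ k) ⟩
  suc l + (d ∸ k)    ∎)
  where open ≡-Reasoning

∈─⇒∉ : ∀ {n} (p q : Subset n) {x} → x ∈ p ─ q → x ∉ q
∈─⇒∉ (_       ∷ p) (_      ∷ q) (there x∈) (there x∈q) = ∈─⇒∉ p q x∈ x∈q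
∈─⇒∉ (inside  ∷ p) (inside ∷ q) ()         here
∈─⇒∉ (outside ∷ p) (inside ∷ q) ()         here

least : ∀ {P : ℕ → Set} → (∀ i → Dec (P i)) → ∀ {k} → P k →
        ∃ λ j → P j × (∀ {i} → P i → j ≤ i)
least P? {zero}  p = zero , p , λ _ → z≤n
least {P} P? {suc k} p with P? 0
... | yes p₀ = zero , p₀ , λ _ → z≤n
... | no ¬p₀ with j , pj , min ← least (P? ∘ suc) {k} p = suc j , pj , min′
  where
  min′ : ∀ {i} → P i → suc j ≤ i
  min′ {zero}  q = contradiction q ¬p₀
  min′ {suc i} q = s≤s (min q)

does⇒ : ∀ {P : Set} (d : Dec P) → does d ≡ true → P
does⇒ (yes p) _ = p

-- Converts a comparison of distances to the root into one of positions along a path.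
∸-reflects : ∀ {d i j} e → j ≤ d → d ∸ i ≤ e + (d ∸ j) → j ≤ i + e
∸-reflects {d} {i} {j} e j≤d h = +-cancelʳ-≤ (d ∸ j) j (i + e) (begin
  j + (d ∸ j)        ≡⟨ m+[n∸m]≡n j≤d ⟩
  d                  ≤⟨ m≤n+m∸n d i ⟩
  i + (d ∸ i)        ≤⟨ +-monoʳ-≤ i h ⟩
  i + (e + (d ∸ j))  ≡⟨ +-assoc i e _ ⟨
  i + e + (d ∸ j)    ∎)
  where open ≤-Reasoning

-- Components, claws and shortest paths in a graph

module _ {n : ℕ} (G : Graph (Fin n)) where

  InducedAdj-sym : ∀ {W u v} → InducedAdj G W u v → InducedAdj G W v u
  InducedAdj-sym (u∈W , v∈W , uv) = v∈W , u∈W , symm G uv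

  record Reach (W : Subset n) (u : Fin n) : Set where
    field
      D           : Subset n
      start       : u ∈ D
      isComponent : IsComponent G W D
      closed      : ∀ {x y} → x ∈ D → y ∈ W → Adj G x y → y ∈ D

  -- The set D grows from u by one neighbour in W at a time. The fuel k satisfies n ≤ |D| + k, so
  -- growth at k = 0 would exceed n vertices.
  reach : ∀ {W u} → u ∈ W → Reach W u
  reach {W} {u} u∈W = grow n ⁅ u ⁆ (m≤n+m n _) (x∈⁅x⁆ u)
    (λ x∈ → subst (_∈ W) (sym (x∈⁅y⁆⇒x≡y u x∈)) u∈W)
    (λ x∈ → subst (Star _ u) (sym (x∈⁅y⁆⇒x≡y u x∈)) ε)
    where
    grow : ∀ k D → n ≤ ∣ D ∣ + k → u ∈ D → D ⊆ W →
           (∀ {x} → x ∈ D → Star (InducedAdj G D) u x) → Reach W u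
    grow k D n≤ u∈D D⊆W walk
      with any? (λ x → any? λ y → x ∈? D ×-dec y ∈? W ×-dec ¬? (y ∈? D) ×-dec adj? G x y)
    ... | no none = record
      { D           = D
      ; start       = u∈D
      ; isComponent = record
        { nonempty  = u , u∈D
        ; within    = D⊆W
        ; connected = λ x∈D y∈D → Star.reverse InducedAdj-sym (walk x∈D) ◅◅ walk y∈D
        ; maximal   = λ E E⊆W E-conn D⊆E y∈E → along E⊆W u∈D (E-conn (D⊆E u∈D) y∈E)
        }
      ; closed      = closed
      }
      where
      closed : ∀ {x y} → x ∈ D → y ∈ W → Adj G x y → y ∈ D
      closed {x} {y} x∈D y∈W xy with y ∈? D
      ... | yes y∈D = y∈D
      ... | no  y∉D = contradiction (x , y , x∈D , y∈W , y∉D , xy) none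

      -- Gives maximality: a walk in W cannot leave the closed set D.
      along : ∀ {E} → E ⊆ W → ∀ {x y} → x ∈ D → Star (InducedAdj G E) x y → y ∈ D
      along E⊆W x∈D ε = x∈D
      along E⊆W x∈D ((_ , z∈E , xz) ◅ zs) = along E⊆W (closed x∈D (E⊆W z∈E) xz) zs
    ... | yes (x , y , x∈D , y∈W , y∉D , xy) = enlarge k n≤
      where
      D′ = D ∪ ⁅ y ⁆

      D⊆D′ : D ⊆ D′
      D⊆D′ = p⊆p∪q ⁅ y ⁆

      y∈D′ : y ∈ D′
      y∈D′ = q⊆p∪q D ⁅ y ⁆ (x∈⁅x⁆ y)

      larger : ∣ D ∣ < ∣ D′ ∣
      larger = p⊂q⇒∣p∣<∣q∣ (D⊆D′ , y , y∈D′ , y∉D)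

      lift : ∀ {a b} → Star (InducedAdj G D) a b → Star (InducedAdj G D′) a b
      lift = Star.map λ (a∈ , b∈ , ab) → D⊆D′ a∈ , D⊆D′ b∈ , ab

      D′⊆W : D′ ⊆ W
      D′⊆W z∈ with x∈p∪q⁻ D ⁅ y ⁆ z∈
      ... | inj₁ z∈D = D⊆W z∈D
      ... | inj₂ z∈y = subst (_∈ W) (sym (x∈⁅y⁆⇒x≡y y z∈y)) y∈W

      walk′ : ∀ {z} → z ∈ D′ → Star (InducedAdj G D′) u z
      walk′ z∈ with x∈p∪q⁻ D ⁅ y ⁆ z∈
      ... | inj₁ z∈D = lift (walk z∈D)
      ... | inj₂ z∈y = subst (Star _ u) (sym (x∈⁅y⁆⇒x≡y y z∈y))
                         (lift (walk x∈D) ◅◅ ((D⊆D′ x∈D , y∈D′ , xy) ◅ ε))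

      enlarge : ∀ k → n ≤ ∣ D ∣ + k → Reach W u
      enlarge zero    n≤ = contradiction larger
        (≤⇒≯ (≤-trans (∣p∣≤n D′) (≤-trans n≤ (≤-reflexive (+-identityʳ _)))))
      enlarge (suc k) n≤ = grow k D′
        (≤-trans n≤ (≤-trans (≤-reflexive (+-suc _ k)) (+-monoˡ-≤ k larger)))
        (D⊆D′ u∈D) D′⊆W walk′

  abstract
    -- Empty, hence not a component, when u ∉ W.
    componentOf : Subset n → Fin n → Subset n
    componentOf W u with u ∈? W
    ... | yes u∈W = Reach.D (reach u∈W)
    ... | no  _   = ⊥

    componentOf-bound : ∀ {W a b} → (∀ D → IsComponent G W D → a * ∣ D ∣ ≤ b) →
                        ∀ u → a * ∣ componentOf W u ∣ ≤ b
    componentOf-bound {W} {a} h u with u ∈? W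
    ... | yes u∈W = h _ (Reach.isComponent (reach u∈W))
    ... | no  _   = ≤-trans (≤-reflexive (trans (cong (a *_) (∣⊥∣≡0 n)) (*-zeroʳ a))) z≤n

    start∈componentOf : ∀ {W u} → u ∈ W → u ∈ componentOf W u
    start∈componentOf {W} {u} u∈W with u ∈? W
    ... | yes u∈W′ = Reach.start (reach u∈W′)
    ... | no  u∉W  = contradiction u∈W u∉W

    componentOf-closed : ∀ {W u x y} → x ∈ componentOf W u → y ∈ W → Adj G x y →
                         y ∈ componentOf W u
    componentOf-closed {W} {u} x∈ with u ∈? W
    ... | yes u∈W = Reach.closed (reach u∈W) x∈
    ... | no  _   = contradiction x∈ ∉⊥

  -- Its negation is what induced legs need of each other, and membership in N[X] means touching a
  -- vertex of X.
  Touch : Fin n → Fin n → Set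
  Touch x y = x ≡ y ⊎ Adj G x y

  touch? : ∀ x y → Dec (Touch x y)
  touch? x y = x ≟ y ⊎-dec adj? G x y

  touch-sym : ∀ {x y} → Touch x y → Touch y x
  touch-sym (inj₁ e) = inj₁ (sym e)
  touch-sym (inj₂ a) = inj₂ (symm G a)

  ∈N[]⇒touch : ∀ X {y} → y ∈ N[_] G X → ∃ λ x → x ∈ X × Touch x y
  ∈N[]⇒touch X {y} y∈N
    with does⇒ (y ∈? X ⊎-dec any? λ u → u ∈? X ×-dec adj? G y u)
               (trans (sym (lookup∘tabulate _ y)) ([]=⇒lookup y∈N))
  ... | inj₁ y∈X            = y , y∈X , inj₁ refl
  ... | inj₂ (x , x∈X , yx) = x , x∈X , inj₂ (symm G yx)

  touch⇒∈N[] : ∀ X {x y} → x ∈ X → Touch x y → y ∈ N[_] G X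
  touch⇒∈N[] X {x} {y} x∈X xy = lookup⇒[]= y _ (trans (lookup∘tabulate _ y)
    (dec-true (y ∈? X ⊎-dec any? λ u → u ∈? X ×-dec adj? G y u) (near xy)))
    where
    near : Touch x y → y ∈ X ⊎ ∃ λ u → u ∈ X × Adj G y u
    near (inj₁ refl) = inj₁ x∈X
    near (inj₂ a)    = inj₂ (x , x∈X , symm G a)

  -- As touching includes equality, `separated` also makes distinct legs disjoint.
  record ClawLegs (t : ℕ) (x : Fin n) (P : Fin 3 → Fin t → Fin n) : Set where
    field
      centre≢   : ∀ i k → x ≢ P i k
      centreAdj : ∀ i k → Adj G x (P i k) ⇔ toℕ k ≡ 0
      injective : ∀ i {k l} → P i k ≡ P i l → k ≡ l
      legAdj    : ∀ i k l → Adj G (P i k) (P i l) ⇔ (toℕ l ≡ suc (toℕ k) ⊎ toℕ k ≡ suc (toℕ l))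
      separated : ∀ {i j} → i ≢ j → ∀ k l → ¬ Touch (P i k) (P j l)

  clawLegs⇒induced : ∀ {t x P} → ClawLegs t x P → S t IsInducedIn G
  clawLegs⇒induced {t} {x} {P} claw = mk↣ {to = f} f-inj , λ a b → mk⇔ (to a b) (from a b)
    where
    open ClawLegs claw
    module E {A B : Set} (e : A ⇔ B) = Equivalence e

    f : SVertex t → Fin n
    f centre    = x
    f (leg i k) = P i k

    f-inj : ∀ {a b} → f a ≡ f b → a ≡ b
    f-inj {centre}  {centre}  e = refl
    f-inj {centre}  {leg i k} e = contradiction e (centre≢ i k)
    f-inj {leg i k} {centre}  e = contradiction (sym e) (centre≢ i k)
    f-inj {leg i k} {leg j l} e with i ≟ j
    ... | yes refl = cong (leg i) (injective i e)
    ... | no  i≢j  = contradiction (inj₁ e) (separated i≢j k l)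

    edge : ∀ {a b} → SEdge a b → Adj G (f a) (f b)
    edge (hub {i} {k} e)      = E.from (centreAdj i k) e
    edge (next {i} {k} {l} e) = E.from (legAdj i k l) (inj₁ e)

    to : ∀ a b → Adj (S t) a b → Adj G (f a) (f b)
    to a b (fwd e) = edge e
    to a b (bwd e) = symm G (edge e)

    from : ∀ a b → Adj G (f a) (f b) → Adj (S t) a b
    from centre    centre    e = contradiction e (loopless G)
    from centre    (leg i k) e = fwd (hub (E.to (centreAdj i k) e))
    from (leg i k) centre    e = bwd (hub (E.to (centreAdj i k) (symm G e)))
    from (leg i k) (leg j l) e with i ≟ j
    ... | no  i≢j  = contradiction (inj₂ e) (separated i≢j k l)
    ... | yes refl with E.to (legAdj i k l) e
    ...   | inj₁ p = fwd (next p)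
    ...   | inj₂ p = bwd (next p)

  -- Shortest paths to a root inside a connected set

  module BreadthFirst (C : Subset n) (C-conn : IsConnected G C) {r : Fin n} (r∈C : r ∈ C) where

    -- A walk of length exactly k to r whose vertices after v lie in C; fixing the length makes it
    -- decidable.
    Walk : ℕ → Fin n → Set
    Walk zero    v = v ≡ r
    Walk (suc k) v = ∃ λ w → w ∈ C × Adj G v w × Walk k w

    walk? : ∀ k v → Dec (Walk k v)
    walk? zero    v = v ≟ r
    walk? (suc k) v = any? λ w → w ∈? C ×-dec adj? G v w ×-dec walk? k w

    star⇒walk : ∀ {v} → Star (InducedAdj G C) v r → ∃ λ k → Walk k v
    star⇒walk ε = zero , refl
    star⇒walk ((_ , w∈C , vw) ◅ ws) with k , walk ← star⇒walk ws = suc k , _ , w∈C , vw , walk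

    distance : ∀ {v} → v ∈ C → ∃ λ d → Walk d v × (∀ {k} → Walk k v → d ≤ k)
    distance {v} v∈C = least (λ k → walk? k v) (proj₂ (star⇒walk (C-conn v∈C r∈C)))

    abstract
      -- The distance to r within C; the value 0 outside C is a mere default.
      δ : Fin n → ℕ
      δ v with v ∈? C
      ... | yes v∈C = proj₁ (distance v∈C)
      ... | no  _   = 0

      δ-walk : ∀ {v} → v ∈ C → Walk (δ v) v
      δ-walk {v} v∈C with v ∈? C
      ... | yes v∈C′ = proj₁ (proj₂ (distance v∈C′))
      ... | no  v∉C  = contradiction v∈C v∉C

      δ-minimal : ∀ {v k} → v ∈ C → Walk k v → δ v ≤ k
      δ-minimal {v} v∈C walk with v ∈? C
      ... | yes v∈C′ = proj₂ (proj₂ (distance v∈C′)) walk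
      ... | no  v∉C  = contradiction v∈C v∉C

    δ≡0⇒root : ∀ {v} → v ∈ C → δ v ≡ 0 → v ≡ r
    δ≡0⇒root v∈C e = subst (λ d → Walk d _) e (δ-walk v∈C)

    δ-lipschitz : ∀ {u v} → u ∈ C → v ∈ C → Touch u v → δ u ≤ suc (δ v)
    δ-lipschitz u∈C v∈C (inj₁ refl) = n≤1+n _
    δ-lipschitz u∈C v∈C (inj₂ uv)   = δ-minimal u∈C (_ , v∈C , uv , δ-walk v∈C)

    -- Conditional fields make the parent a total function of v. With `pred`, the root is forced to
    -- be its own parent.
    record Parent (v : Fin n) : Set where
      field
        π    : Fin n
        π∈C  : v ∈ C → π ∈ C
        δ-π  : v ∈ C → δ π ≡ pred (δ v)
        adj  : v ∈ C → 0 < δ v → Adj G v π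

    parent∈ : ∀ {v} → v ∈ C → Parent v
    parent∈ {v} v∈C with δ v in eq | δ-walk v∈C
    ... | zero  | _ = record
      { π = v ; π∈C = id
      ; δ-π = λ _ → trans eq (sym (cong pred eq))
      ; adj = λ _ 0<δ → contradiction (subst (0 <_) eq 0<δ) λ () }
    ... | suc k | w , w∈C , vw , walk = record
      { π = w ; π∈C = λ _ → w∈C
      ; δ-π = λ _ → trans (≤-antisym (δ-minimal w∈C walk)
          (≤-pred (subst (_≤ suc (δ w)) eq (δ-lipschitz v∈C w∈C (inj₂ vw))))) (sym (cong pred eq))
      ; adj = λ _ _ → vw }

    parent : ∀ v → Parent v
    parent v with v ∈? C
    ... | yes v∈C = parent∈ v∈C
    ... | no  v∉C = record
      { π = v ; π∈C = id
      ; δ-π = λ v∈C → contradiction v∈C v∉C ; adj = λ v∈C → contradiction v∈C v∉C }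

    -- The shortest path from u to r as an infinite sequence, constantly r from position δ u on.
    path : Fin n → ℕ → Fin n
    path u zero    = u
    path u (suc i) = Parent.π (parent (path u i))

    module _ {u : Fin n} (u∈C : u ∈ C) where

      path-∈ : ∀ i → path u i ∈ C
      path-∈ zero    = u∈C
      path-∈ (suc i) = Parent.π∈C (parent (path u i)) (path-∈ i)

      δ-path : ∀ i → δ (path u i) ≡ δ u ∸ i
      δ-path zero    = refl
      δ-path (suc i) = trans (Parent.δ-π (parent (path u i)) (path-∈ i))
        (trans (cong pred (δ-path i)) (pred[m∸n]≡m∸[1+n] (δ u) i))

      path-adj : ∀ {i} → i < δ u → Adj G (path u i) (path u (suc i))
      path-adj {i} i<δ = Parent.adj (parent (path u i)) (path-∈ i)
        (subst (0 <_) (sym (δ-path i)) (m<n⇒0<n∸m i<δ))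

      path-root : ∀ {i} → δ u ≤ i → path u i ≡ r
      path-root {i} δ≤i = δ≡0⇒root (path-∈ i) (trans (δ-path i) (m≤n⇒m∸n≡0 δ≤i))

      path-touch : ∀ i → Touch (path u i) (path u (suc i))
      path-touch i with i <? δ u
      ... | yes i<δ = inj₂ (path-adj i<δ)
      ... | no  i≮δ = inj₁ (trans (path-root (≮⇒≥ i≮δ)) (sym (path-root (m≤n⇒m≤1+n (≮⇒≥ i≮δ)))))

      -- Shortest paths have no chords: the distance to r drops by one per position but changes by
      -- at most one between touching vertices. The bound on j excludes the constant tail.
      path-lipschitz : ∀ {i j} → j ≤ δ u → Touch (path u i) (path u j) → j ≤ suc i
      path-lipschitz {i} {j} j≤δ touch = ≤-trans (∸-reflects {i = i} 1 j≤δ (begin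
        δ u ∸ i              ≡⟨ δ-path i ⟨
        δ (path u i)         ≤⟨ δ-lipschitz (path-∈ i) (path-∈ j) touch ⟩
        suc (δ (path u j))   ≡⟨ cong suc (δ-path j) ⟩
        suc (δ u ∸ j)        ∎)) (≤-reflexive (+-comm i 1))
        where open ≤-Reasoning

      path-injective : ∀ {i j} → i ≤ δ u → j ≤ δ u → path u i ≡ path u j → i ≡ j
      path-injective {i} {j} i≤δ j≤δ e = ∸-cancelˡ-≡ i≤δ j≤δ
        (trans (sym (δ-path i)) (trans (cong δ e) (δ-path j)))

      path-induced : ∀ {i j} → i ≤ δ u → j ≤ δ u →
                     Adj G (path u i) (path u j) → j ≡ suc i ⊎ i ≡ suc j
      path-induced {i} {j} i≤δ j≤δ a
        with m≤n⇒m<n∨m≡n (path-lipschitz {i} {j} j≤δ (inj₂ a))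
           | m≤n⇒m<n∨m≡n (path-lipschitz {j} {i} i≤δ (inj₂ (symm G a)))
      ... | inj₂ e | _      = inj₁ e
      ... | _      | inj₂ e = inj₂ e
      ... | inj₁ (s≤s j≤i) | inj₁ (s≤s i≤j) with refl ← ≤-antisym i≤j j≤i = contradiction a (loopless G)

    module _ {W : Subset n} {w : Fin n} where

      touch-closed : ∀ {x y} → x ∈ componentOf W w → y ∈ W → Touch x y → y ∈ componentOf W w
      touch-closed x∈ y∈W (inj₁ refl) = x∈
      touch-closed x∈ y∈W (inj₂ xy)   = componentOf-closed x∈ y∈W xy

      module _ {u : Fin n} (u∈C : u ∈ C) where

        path-forward : ∀ {k} → (∀ {i} → i ≤ k → path u i ∈ W) →
                       u ∈ componentOf W w → path u k ∈ componentOf W w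
        path-forward {zero}  _  u∈ = u∈
        path-forward {suc k} in-W u∈ = touch-closed
          (path-forward (in-W ∘ m≤n⇒m≤1+n) u∈) (in-W ≤-refl) (path-touch u∈C k)

        path-back : ∀ {k} → (∀ {i} → i ≤ k → path u i ∈ W) →
                    path u k ∈ componentOf W w → u ∈ componentOf W w
        path-back {zero}  _  ∈comp = ∈comp
        path-back {suc k} in-W ∈comp = path-back (in-W ∘ m≤n⇒m≤1+n)
          (touch-closed ∈comp (in-W (n≤1+n k)) (touch-sym (path-touch u∈C k)))

    record FirstExit (W : Subset n) (u : Fin n) : Set where
      field
        index  : ℕ
        bound  : index ≤ δ u
        exit   : path u index ∉ W
        before : ∀ {i} → i < index → path u i ∈ W

    -- A path staying in W as far as r would put u into the component of r.
    firstExit : ∀ {W u} → u ∈ C → u ∉ componentOf W r → FirstExit W u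
    firstExit {W} {u} u∈C u∉ with anyUpTo? (λ i → ¬? (path u i ∈? W)) (suc (δ u))
    ... | yes (i , s≤s i≤δ , i∉W) with j , j∉W , min ← least (λ i → ¬? (path u i ∈? W)) {i} i∉W = record
      { index = j ; bound = ≤-trans (min i∉W) i≤δ ; exit = j∉W
      ; before = λ {k} k<j → decidable-stable (path u k ∈? W) λ k∉W → <⇒≱ k<j (min k∉W) }
    ... | no none = contradiction (path-back u∈C in-W (subst (_∈ componentOf W r)
          (sym (path-root u∈C ≤-refl))
          (start∈componentOf (subst (_∈ W) (path-root u∈C ≤-refl) (in-W ≤-refl))))) u∉
      where
      in-W : ∀ {i} → i ≤ δ u → path u i ∈ W
      in-W {i} i≤δ = decidable-stable (path u i ∈? W) λ i∉W → none (i , s≤s i≤δ , i∉W)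

    -- Both paths end at r, so position δ u is a contact and a least one exists.
    firstContact : ∀ {u v} → u ∈ C → v ∈ C →
      ∃ λ α → (∃ λ j → j ≤ δ v × Touch (path u α) (path v j)) ×
              (∀ {i j} → Touch (path u i) (path v j) → α ≤ i)
    firstContact {u} {v} u∈C v∈C =
      let α , (j , j<1+δ , c) , min = least meets? {δ u} (restrict {δ u} {δ v} roots-touch)
      in  α , (j , ≤-pred j<1+δ , c) , λ {i} {j} c′ → min {i} (restrict {i} {j} c′)
      where
      Meets : ℕ → Set
      Meets i = ∃ λ j → j < suc (δ v) × Touch (path u i) (path v j)

      meets? : ∀ i → Dec (Meets i)
      meets? i = anyUpTo? (λ j → touch? (path u i) (path v j)) (suc (δ v))

      -- Past δ v the second path rests at r, so position δ v serves instead.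
      restrict : ∀ {i j} → Touch (path u i) (path v j) → Meets i
      restrict {i} {j} c with j ≤? δ v
      ... | yes j≤δ = j , s≤s j≤δ , c
      ... | no  j≰δ = δ v , ≤-refl , subst (Touch (path u i))
        (trans (path-root v∈C (<⇒≤ (≰⇒> j≰δ))) (sym (path-root v∈C ≤-refl))) c

      roots-touch : Touch (path u (δ u)) (path v (δ v))
      roots-touch = inj₁ (trans (path-root u∈C ≤-refl) (sym (path-root v∈C ≤-refl)))

    module Contacts {u v : Fin n} (u∈C : u ∈ C) (v∈C : v ∈ C) where

      α β : ℕ
      α = proj₁ (firstContact u∈C v∈C)
      β = proj₁ (firstContact v∈C u∈C)

      -- Three consecutive vertices are taken on the path of v because the partner of `path u α` may
      -- lie up to two steps beyond β.
      contact : Fin 4 → Fin n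
      contact zero    = path u α
      contact (suc q) = path v (toℕ q + β)

      contact-∈ : ∀ q → contact q ∈ C
      contact-∈ zero    = path-∈ u∈C α
      contact-∈ (suc q) = path-∈ v∈C (toℕ q + β)

      private
        j₀ : ℕ
        j₀ = proj₁ (proj₁ (proj₂ (firstContact u∈C v∈C)))

        j₀≤δ : j₀ ≤ δ v
        j₀≤δ = proj₁ (proj₂ (proj₁ (proj₂ (firstContact u∈C v∈C))))

        touch₀ : Touch (path u α) (path v j₀)
        touch₀ = proj₂ (proj₂ (proj₁ (proj₂ (firstContact u∈C v∈C))))

        α-min : ∀ {i j} → Touch (path u i) (path v j) → α ≤ i
        α-min {i} {j} = proj₂ (proj₂ (firstContact u∈C v∈C)) {i} {j}

        β-min : ∀ {i j} → Touch (path u i) (path v j) → β ≤ j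
        β-min {i} {j} c = proj₂ (proj₂ (firstContact v∈C u∈C)) {j} {i} (touch-sym c)

        i₁ : ℕ
        i₁ = proj₁ (proj₁ (proj₂ (firstContact v∈C u∈C)))

        touch₁ : Touch (path v β) (path u i₁)
        touch₁ = proj₂ (proj₂ (proj₁ (proj₂ (firstContact v∈C u∈C))))

      -- Along both paths the distance to r drops by one per step and touching
      -- vertices differ by at most one in distance; as α ≤ i₁, the contact of
      -- path u α lies at most two steps behind β.
      j₀≤β+2 : j₀ ≤ β + 2
      j₀≤β+2 = ∸-reflects {i = β} 2 j₀≤δ (begin
        δ v ∸ β                   ≡⟨ δ-path v∈C β ⟨
        δ (path v β)              ≤⟨ δ-lipschitz (path-∈ v∈C β) (path-∈ u∈C i₁) touch₁ ⟩
        suc (δ (path u i₁))       ≡⟨ cong suc (δ-path u∈C i₁) ⟩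
        suc (δ u ∸ i₁)            ≤⟨ s≤s (∸-monoʳ-≤ (δ u) (α-min {i₁} {β} (touch-sym touch₁))) ⟩
        suc (δ u ∸ α)             ≡⟨ cong suc (δ-path u∈C α) ⟨
        suc (δ (path u α))        ≤⟨ s≤s (δ-lipschitz (path-∈ u∈C α) (path-∈ v∈C j₀) touch₀) ⟩
        2 + δ (path v j₀)         ≡⟨ cong (2 +_) (δ-path v∈C j₀) ⟩
        2 + (δ v ∸ j₀)            ∎)
        where open ≤-Reasoning

      -- If the prefixes touched, then a > α and b > β + 2 ≥ j₀, so that
      -- u … path u α – path v j₀ … v would avoid the complement of W.
      prefixes-apart : ∀ {W a b} →
        (∀ {i} → i < a → path u i ∈ W) → path u a ∉ W →
        (∀ {j} → j < b → path v j ∈ W) → path v b ∉ W →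
        (∀ q → contact q ∈ W) → v ∉ componentOf W u →
        ∀ {i j} → i ≤ a → j ≤ b → ¬ Touch (path u i) (path v j)
      prefixes-apart {W} {a} {b} u-in a∉ v-in b∉ contact∈W v∉ {i} {j} i≤a j≤b c = v∉ (path-back
        v∈C (λ j≤j₀ → v-in (≤-<-trans j≤j₀ j₀<b))
        (touch-closed (path-forward u∈C (λ i≤α → u-in (≤-<-trans i≤α α<a))
                                    (start∈componentOf (u-in (≤-<-trans z≤n α<a))))
                      (v-in j₀<b) touch₀))
        where
        α<a : α < a
        α<a = ≤∧≢⇒< (≤-trans (α-min {i} {j} c) i≤a)
          λ e → a∉ (subst (λ i → path u i ∈ W) e (contact∈W zero))

        β+k≢b : ∀ (q : Fin 3) → toℕ q + β ≢ b
        β+k≢b q e = b∉ (subst (λ j → path v j ∈ W) e (contact∈W (suc q)))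

        -- The exit b is at least β, and the contacts at β, β + 1 and β + 2 lie in W, which rules
        -- out each as the exit.
        β+2<b : 2 + β < b
        β+2<b = ≤∧≢⇒< (≤∧≢⇒< (≤∧≢⇒< (≤-trans (β-min {i} {j} c) j≤b) (β+k≢b zero))
                  (β+k≢b (suc zero))) (β+k≢b (suc (suc zero)))

        j₀<b : j₀ < b
        j₀<b = ≤-<-trans (≤-trans j₀≤β+2 (≤-reflexive (+-comm β 2))) β+2<b

-- Compatible triples give claws

module _ {n : ℕ} (G : Graph (Fin n)) {V′ C : Subset n} (C-largest : IsLargestComponent G V′ C) where

  open IsComponent (proj₁ C-largest) renaming (nonempty to C-nonempty; within to C⊆V′; connected to C-conn)
  open BreadthFirst G C C-conn (proj₂ C-nonempty)

  private
    r = proj₁ C-nonempty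
    m = ∣ C ∣

  record Leg (W : Subset n) (t : ℕ) (x u : Fin n) : Set where
    field
      u∈C   : u ∈ C
      exits : FirstExit W u
    open FirstExit exits public
    field
      touch : Touch G x (path u index)
      long  : t ≤ index

    -- Counted back from the exit, so that index 0 is the vertex next to the centre.
    vertex : Fin t → Fin n
    vertex k = path u (index ∸ toℕ k)

    k≤index : ∀ (k : Fin t) → toℕ k ≤ index
    k≤index k = ≤-trans (<⇒≤ (toℕ<n k)) long

    0<index : Fin t → 0 < index
    0<index k = <-≤-trans (≤-<-trans z≤n (toℕ<n k)) long

    inner : ∀ (k : Fin t) → toℕ k ≢ 0 → index ∸ toℕ k < index
    inner k k≢0 = ∸-monoʳ-< (n≢0⇒n>0 k≢0) (k≤index k)

    vertex≤δ : ∀ (k : Fin t) → index ∸ toℕ k ≤ δ u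
    vertex≤δ k = ≤-trans (m∸n≤m index (toℕ k)) bound

  module _ {W : Subset n} {t : ℕ} {x : Fin n} (u : Fin 3 → Fin n) (leg : ∀ i → Leg W t x (u i))
    (clear : ∀ {y} → y ∈ W → ¬ Touch G x y)
    (apart : ∀ {i j} → i ≢ j → ∀ {a b} → a ≤ Leg.index (leg i) → b ≤ Leg.index (leg j) →
             ¬ Touch G (path (u i) a) (path (u j) b)) where

    private module L (i : Fin 3) = Leg (leg i)

    -- The last vertex before the exit would be a neighbour of x in W.
    x≢exit : ∀ i → Fin t → x ≢ path (u i) (L.index i)
    x≢exit i k x≡ with L.index i | L.0<index i k | L.before i {pred (L.index i)} | L.bound i
    ... | suc p | _ | before | p<δ = clear (before ≤-refl)
      (inj₂ (symm G (subst (Adj G _) (sym x≡) (path-adj (L.u∈C i) p<δ))))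

    -- Every leg vertex but the exit lies in W, where x touches nothing; each leg is induced as a
    -- segment of a shortest path.
    legs : ClawLegs G t x L.vertex
    legs = record
      { centre≢   = centre≢
      ; centreAdj = λ i k → mk⇔
          (λ a → decidable-stable (toℕ k ℕ.≟ 0) λ k≢0 → clear (L.before i (L.inner i k k≢0)) (inj₂ a))
          (centre-exit i k)
      ; injective = λ i {k} {l} e → toℕ-injective (∸-cancelˡ-≡ (L.k≤index i k) (L.k≤index i l)
          (path-injective (L.u∈C i) (L.vertex≤δ i k) (L.vertex≤δ i l) e))
      ; legAdj    = λ i k l → mk⇔ (legAdj⇒ i k l) λ
          { (inj₁ e) → symm G (consecutive i l k e) ; (inj₂ e) → consecutive i k l e }
      ; separated = λ {i} {j} i≢j k l → apart i≢j (m∸n≤m (L.index i) (toℕ k)) (m∸n≤m (L.index j) (toℕ l))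
      }
      where
      centre≢ : ∀ i k → x ≢ L.vertex i k
      centre≢ i k e with toℕ k ℕ.≟ 0
      ... | no k≢0  = clear (L.before i (L.inner i k k≢0)) (inj₁ e)
      ... | yes k≡0 = x≢exit i k (trans e (cong (λ j → path (u i) (L.index i ∸ j)) k≡0))

      centre-exit : ∀ i k → toℕ k ≡ 0 → Adj G x (L.vertex i k)
      centre-exit i k k≡0 with L.touch i
      ... | inj₁ e = contradiction e (x≢exit i k)
      ... | inj₂ a = subst (λ j → Adj G x (path (u i) (L.index i ∸ j))) (sym k≡0) a

      legAdj⇒ : ∀ i k l → Adj G (L.vertex i k) (L.vertex i l) → toℕ l ≡ suc (toℕ k) ⊎ toℕ k ≡ suc (toℕ l)
      legAdj⇒ i k l a with path-induced (L.u∈C i) (L.vertex≤δ i k) (L.vertex≤δ i l) a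
      ... | inj₁ e = inj₂ (∸-step {L.index i} (L.k≤index i k) (L.k≤index i l) e)
      ... | inj₂ e = inj₁ (∸-step {L.index i} (L.k≤index i l) (L.k≤index i k) e)

      consecutive : ∀ i k l → toℕ k ≡ suc (toℕ l) → Adj G (L.vertex i k) (L.vertex i l)
      consecutive i k l e = subst (λ j → Adj G (L.vertex i k) (path (u i) j)) shift
        (path-adj (L.u∈C i) (<-≤-trans (L.inner i k λ k≡0 → 1+n≢0 (trans (sym e) k≡0)) (L.bound i)))
        where
        shift : suc (L.index i ∸ toℕ k) ≡ L.index i ∸ toℕ l
        shift = begin
          suc (L.index i ∸ toℕ k)        ≡⟨ cong (λ j → suc (L.index i ∸ j)) e ⟩
          suc (L.index i ∸ suc (toℕ l))  ≡⟨ +-∸-assoc 1 (subst (_≤ L.index i) e (L.k≤index i k)) ⟨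
          L.index i ∸ toℕ l              ∎
          where open ≡-Reasoning

  -- Obstacles, colours and bad pairs

  module _ (t : ℕ) where

    -- Avoiding the contacts keeps the prefixes of the two paths apart, and
    -- avoiding the first t vertices makes the prefix of u long.
    obstacle : Fin m → Fin m → Fin (4 + t) → Fin n
    obstacle u v q = [ Contacts.contact (enum-∈ C u) (enum-∈ C v) , path (enum C u) ∘ toℕ ]′ (splitAt 4 q)

    obstacle-∈ : ∀ u v q → obstacle u v q ∈ C
    obstacle-∈ u v q with splitAt 4 q
    ... | inj₁ q′ = Contacts.contact-∈ (enum-∈ C u) (enum-∈ C v) q′
    ... | inj₂ i  = path-∈ (enum-∈ C u) (toℕ i)

    hits : Subset n → Fin m → Fin m → ℕ
    hits Y u v = sum λ q → 𝟙 (obstacle u v q ∈? Y)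

    totalHits : Subset n → ℕ
    totalHits Y = sum λ u → sum λ v → hits Y u v

    module _ {s : ℕ} .{{_ : NonZero s}} {Y : Subset n} (sep : IsBoostedSeparator G V′ s Y) where

      private
        W = V′ ─ Y
        X = proj₁ sep
        module Sep = IsBoostedSeparatorWithCore (proj₂ sep)

        -- `Sep.C` may differ from C, but as a component it is no larger.
        component-bound : ∀ w → 16 * s ^ 2 * ∣ componentOf G W w ∣ ≤ m
        component-bound w = ≤-trans (componentOf-bound G {W} {16 * s ^ 2} Sep.balanced w)
                                    (proj₂ C-largest Sep.C (proj₁ Sep.C-largest))

      -- The second term is zero only if the path of u must meet Y, which gives u a genuine colour.
      separation-failures : Fin m → Fin m → ℕ
      separation-failures u v = 𝟙 (enum C v ∈? componentOf G W (enum C u)) + 𝟙 (enum C u ∈? componentOf G W r)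

      ρ : Fin m → Fin m → ℕ
      ρ u v = separation-failures u v + hits Y u v

      -- A vertex of V′ touching the core is in Y, even if the core vertex lies outside V′.
      W-clear : ∀ {x y} → x ∈ X → y ∈ W → ¬ Touch G x y
      W-clear {x} {y} x∈X y∈W xy = ∈─⇒∉ V′ Y y∈W (subst (y ∈_) (sym Sep.Y≡N)
        (x∈p∩q⁺ (touch⇒∈N[] G X x∈X xy , p─q⊆p V′ Y y∈W)))

      -- Colours are positions in the core, embedded in `Fin s` by `core-size`.
      Coloured : Fin m → Fin s → Set
      Coloured u k = enum C u ∉ componentOf G W r →
        Σ (FirstExit W (enum C u)) λ e → ∃ λ i → inject≤ i Sep.core-size ≡ k ×
          Touch G (enum X i) (path (enum C u) (FirstExit.index e))

      colouring : ∀ u → ∃ (Coloured u)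
      colouring u with enum C u ∈? componentOf G W r
      -- An arbitrary colour, available because s is positive.
      ... | yes u∈ = fromℕ< (>-nonZero⁻¹ s) , λ u∉ → contradiction u∈ u∉
      ... | no  u∉ = inject≤ i Sep.core-size , λ _ → e , i , refl ,
            subst (λ z → Touch G z v) (sym (proj₂ (enum-surjective x∈X))) xy
        where
        e = firstExit (enum-∈ C u) u∉
        v = path (enum C u) (FirstExit.index e)
        v∈Y : v ∈ Y
        v∈Y = decidable-stable (v ∈? Y) λ ∉Y →
          FirstExit.exit e (x∈p∧x∉q⇒x∈p─q (C⊆V′ (path-∈ (enum-∈ C u) (FirstExit.index e))) ∉Y)
        near = ∈N[]⇒touch G X (proj₁ (x∈p∩q⁻ _ V′ (subst (v ∈_) Sep.Y≡N v∈Y)))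
        x∈X = proj₁ (proj₂ near)
        xy = proj₂ (proj₂ near)
        i = proj₁ (enum-surjective x∈X)

      colour : Fin m → Fin s
      colour = proj₁ ∘ colouring

      -- The cyclic pairs cover all pairs of legs up to symmetry, and each of the three vertices
      -- comes first in one of them.
      claw : CompatibleTriple colour ρ → .{{NonZero t}} → S t IsInducedIn G
      claw (u₀ , u₁ , u₂ , k₀₁ , k₁₂ , ρ₀₁ , ρ₁₂ , ρ₂₀) =
        clawLegs⇒induced G (legs (enum C ∘ u) arm (W-clear (enum-∈ X i₀)) apart)
        where
        succ₃ : Fin 3 → Fin 3
        succ₃ zero             = suc zero
        succ₃ (suc zero)       = suc (suc zero)
        succ₃ (suc (suc zero)) = zero

        u : Fin 3 → Fin m
        u zero             = u₀
        u (suc zero)       = u₁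
        u (suc (suc zero)) = u₂

        compatible : ∀ i → ρ (u i) (u (succ₃ i)) ≡ 0
        compatible zero             = ρ₀₁
        compatible (suc zero)       = ρ₁₂
        compatible (suc (suc zero)) = ρ₂₀

        module _ (i : Fin 3) where
          no-failure : separation-failures (u i) (u (succ₃ i)) ≡ 0
          no-failure = m+n≡0⇒m≡0 _ (compatible i)

          no-hits : hits Y (u i) (u (succ₃ i)) ≡ 0
          no-hits = m+n≡0⇒n≡0 (separation-failures (u i) (u (succ₃ i))) (compatible i)

          avoids : ∀ q → obstacle (u i) (u (succ₃ i)) q ∈ W
          avoids q = x∈p∧x∉q⇒x∈p─q (C⊆V′ (obstacle-∈ (u i) (u (succ₃ i)) q)) (𝟙≡0⇒¬ (_ ∈? Y)
            (n≤0⇒n≡0 (≤-trans (term≤sum (λ q → 𝟙 (obstacle (u i) (u (succ₃ i)) q ∈? Y)) q)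
                              (≤-reflexive no-hits))))

          avoids-contacts : ∀ q → Contacts.contact (enum-∈ C (u i)) (enum-∈ C (u (succ₃ i))) q ∈ W
          avoids-contacts q = subst (λ z → [ Contacts.contact (enum-∈ C (u i)) (enum-∈ C (u (succ₃ i)))
                                            , path (enum C (u i)) ∘ toℕ ]′ z ∈ W)
            (splitAt-↑ˡ 4 q t) (avoids (q ↑ˡ t))

          avoids-start : ∀ q → path (enum C (u i)) (toℕ q) ∈ W
          avoids-start q = subst (λ z → [ Contacts.contact (enum-∈ C (u i)) (enum-∈ C (u (succ₃ i)))
                                         , path (enum C (u i)) ∘ toℕ ]′ z ∈ W)
            (splitAt-↑ʳ 4 t q) (avoids (4 ↑ʳ q))

          cut-from-next : enum C (u (succ₃ i)) ∉ componentOf G W (enum C (u i))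
          cut-from-next = 𝟙≡0⇒¬ (_ ∈? _) (m+n≡0⇒m≡0 _ no-failure)

          cut-from-root : enum C (u i) ∉ componentOf G W r
          cut-from-root = 𝟙≡0⇒¬ (_ ∈? _)
            (m+n≡0⇒n≡0 (𝟙 (enum C (u (succ₃ i)) ∈? componentOf G W (enum C (u i)))) no-failure)

          entry = proj₂ (colouring (u i)) cut-from-root

        i₀ : Fin ∣ X ∣
        i₀ = proj₁ (proj₂ (entry zero))

        same-colour : ∀ i → colour (u i) ≡ colour u₀
        same-colour zero             = refl
        same-colour (suc zero)       = sym k₀₁
        same-colour (suc (suc zero)) = sym (trans k₀₁ k₁₂)

        -- The embedding of core positions is injective, so equal colours name one core vertex.
        same-hub : ∀ i → proj₁ (proj₂ (entry i)) ≡ i₀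
        same-hub i = inject≤-injective Sep.core-size Sep.core-size _ _
          (trans (proj₁ (proj₂ (proj₂ (entry i))))
            (trans (same-colour i) (sym (proj₁ (proj₂ (proj₂ (entry zero)))))))

        arm : ∀ i → Leg W t (enum X i₀) (enum C (u i))
        arm i = record
          { u∈C   = enum-∈ C (u i)
          ; exits = e
          ; touch = subst (λ j → Touch G (enum X j) (path (enum C (u i)) (FirstExit.index e)))
                          (same-hub i) (proj₂ (proj₂ (proj₂ (entry i))))
          -- The first t path vertices are obstacles outside Y, so none of them is the exit.
          ; long  = ≮⇒≥ λ e<t → FirstExit.exit e (subst (λ j → path (enum C (u i)) j ∈ W)
                           (toℕ-fromℕ< e<t) (avoids-start i (fromℕ< e<t)))
          }
          where e = proj₁ (entry i)

        Apart : Fin 3 → Fin 3 → Set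
        Apart i j = ∀ {a b} → a ≤ Leg.index (arm i) → b ≤ Leg.index (arm j) →
          ¬ Touch G (path (enum C (u i)) a) (path (enum C (u j)) b)

        apart-next : ∀ i → Apart i (succ₃ i)
        apart-next i = Contacts.prefixes-apart (enum-∈ C (u i)) (enum-∈ C (u (succ₃ i)))
          (Leg.before (arm i)) (Leg.exit (arm i)) (Leg.before (arm (succ₃ i))) (Leg.exit (arm (succ₃ i)))
          (avoids-contacts i) (cut-from-next i)

        apart-sym : ∀ {i j} → Apart i j → Apart j i
        apart-sym ap a≤ b≤ = ap b≤ a≤ ∘ touch-sym G

        apart : ∀ {i j} → i ≢ j → Apart i j
        apart {zero}           {suc zero}       _ = apart-next zero
        apart {suc zero}       {suc (suc zero)} _ = apart-next (suc zero)
        apart {suc (suc zero)} {zero}           _ = apart-next (suc (suc zero))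
        apart {suc zero}       {zero}           _ = apart-sym {zero} {suc zero} (apart-next zero)
        apart {suc (suc zero)} {suc zero}       _ = apart-sym {suc zero} {suc (suc zero)} (apart-next (suc zero))
        apart {zero}           {suc (suc zero)} _ = apart-sym {suc (suc zero)} {zero} (apart-next (suc (suc zero)))
        apart {zero}           {zero}           i≢i = contradiction refl i≢i
        apart {suc zero}       {suc zero}       i≢i = contradiction refl i≢i
        apart {suc (suc zero)} {suc (suc zero)} i≢i = contradiction refl i≢i

      -- Fix u in the first term and v in the second: either way the other vertex ranges over one
      -- small component.
      failures-bound : 16 * s ^ 2 * sum (λ u → sum (separation-failures u)) ≤ 2 * (m * m)
      failures-bound = begin
        K * sum (λ u → sum (separation-failures u))  ≡⟨ cong (K *_) (sum²-distrib-+ same rooted) ⟩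
        K * (sum (λ u → sum (same u)) + sum (λ u → sum (rooted u)))
          ≡⟨ cong (λ z → K * (sum (λ u → sum (same u)) + z)) (∑-comm rooted) ⟩
        K * (sum (λ u → sum (same u)) + sum (λ v → sum λ u → rooted u v))
          ≡⟨ *-distribˡ-+ K (sum λ u → sum (same u)) _ ⟩
        K * sum (λ u → sum (same u)) + K * sum (λ v → sum λ u → rooted u v)
          ≡⟨ cong₂ _+_ (*-distribˡ-sum K λ u → sum (same u)) (*-distribˡ-sum K λ v → sum λ u → rooted u v) ⟩
        sum (λ u → K * sum (same u)) + sum {m} (λ v → K * sum λ u → rooted u v)
          ≤⟨ +-mono-≤ (sum-≤ m λ u → small (enum C u)) (sum-≤ {m} m λ v → small r) ⟩
        m * m + m * m                                ≡⟨ cong (m * m +_) (+-identityʳ (m * m)) ⟨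
        2 * (m * m)                                  ∎
        where
        open ≤-Reasoning
        K = 16 * s ^ 2

        same rooted : Fin m → Fin m → ℕ
        same   u v = 𝟙 (enum C v ∈? componentOf G W (enum C u))
        rooted u v = 𝟙 (enum C u ∈? componentOf G W r)

        small : ∀ w → K * sum (λ v → 𝟙 (enum C v ∈? componentOf G W w)) ≤ m
        small w = ≤-trans (*-monoʳ-≤ K (sum-enum-∈≤∣∣ C (componentOf G W w))) (component-bound w)

      -- With A failures and H hits, `dense` gives 16sm² ≤ 48s²A + 48s²H, and 48s²A ≤ 6m² ≤ 6m²s.
      -- The 10 is 16 - 6, after cancelling s.
      claw⊎manyHits : .{{NonZero t}} → S t IsInducedIn G ⊎ 10 * (m * m) ≤ 48 * s * totalHits Y
      claw⊎manyHits with compatibleTriple⊎dense colour ρ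
      ... | inj₁ triple = inj₁ (claw triple)
      ... | inj₂ dense  = inj₂ (*-cancelʳ-≤ _ _ s (+-cancelʳ-≤ (6 * (m * m) * s) _ _ (begin
        10 * M * s + 6 * M * s                   ≡⟨ e₁ M s ⟩
        16 * s * M                               ≤⟨ *-monoʳ-≤ (16 * s) dense ⟩
        16 * s * (3 * s * sum (λ u → sum (ρ u))) ≡⟨ cong (λ z → 16 * s * (3 * s * z)) (sum²-distrib-+ separation-failures (hits Y)) ⟩
        16 * s * (3 * s * (A + H))               ≡⟨ e₂ s A H ⟩
        3 * (16 * (s * (s * 1)) * A) + 48 * s * H * s ≤⟨ +-monoˡ-≤ _ (*-monoʳ-≤ 3 failures-bound) ⟩
        3 * (2 * M) + 48 * s * H * s             ≡⟨ e₃ M s H ⟩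
        48 * s * H * s + 6 * M                   ≤⟨ +-monoʳ-≤ (48 * s * H * s) (m≤m*n (6 * M) s) ⟩
        48 * s * H * s + 6 * M * s               ∎)))
        where
        open ≤-Reasoning
        M = m * m
        A = sum λ u → sum (separation-failures u)
        H = totalHits Y
        e₁ : ∀ M s → 10 * M * s + 6 * M * s ≡ 16 * s * M
        e₁ = solve-∀
        e₂ : ∀ s A H → 16 * s * (3 * s * (A + H)) ≡ 3 * (16 * (s * (s * 1)) * A) + 48 * s * H * s
        e₂ = solve-∀
        e₃ : ∀ M s H → 3 * (2 * M) + 48 * s * H * s ≡ 48 * s * H * s + 6 * M
        e₃ = solve-∀

    -- Averaging over the list of separators

    module _ {c : ℕ} (F : List (Subset n)) (bounded : ∀ v → v ∈ V′ → occurrences v F ≤ c) where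

      -- Double counting: each of the m² pairs has 4 + t obstacles, each in at most c members of F.
      sum-totalHits : sum (λ i → totalHits (lookup F i)) ≤ m * (m * ((4 + t) * c))
      sum-totalHits = begin
        sum (λ i → totalHits (lookup F i))
          ≡⟨ ∑-comm (λ i u → sum (hits (lookup F i) u)) ⟩
        sum (λ u → sum λ i → sum (hits (lookup F i) u))
          ≡⟨ sum-cong-≗ (λ u → ∑-comm λ i → hits (lookup F i) u) ⟩
        sum (λ u → sum λ v → sum λ i → hits (lookup F i) u v)
          ≡⟨ sum²-cong (λ u v → ∑-comm λ i q → 𝟙 (obstacle u v q ∈? lookup F i)) ⟩
        sum (λ u → sum λ v → sum λ q → sum λ i → 𝟙 (obstacle u v q ∈? lookup F i))
          ≡⟨ sum²-cong (λ u v → sum-cong-≗ λ q → occurrences≡sum (obstacle u v q) F) ⟨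
        sum (λ u → sum λ v → sum λ q → occurrences (obstacle u v q) F)
          ≤⟨ sum-≤ _ (λ u → sum-≤ _ λ v → sum-≤ c λ q → bounded _ (C⊆V′ (obstacle-∈ u v q))) ⟩
        m * (m * ((4 + t) * c))  ∎
        where open ≤-Reasoning

      -- Summed over F, the assumed bounds would give 800stcm² ≤ 240stcm², although stcm² is
      -- positive.
      ¬manyHits : ∀ {s} .{{_ : NonZero s}} .{{_ : NonZero t}} .{{_ : NonZero c}} →
        length F ≥ 80 * s * t * c →
        ¬ (∀ i → 10 * (m * m) ≤ 48 * s * totalHits (lookup F i))
      ¬manyHits {s} long many = <⇒≱ (*-monoˡ-< X {{X≢0}} (m<m+n 240 {560} (s≤s z≤n))) (begin
        800 * X                                        ≡⟨ e₁ s t c m ⟩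
        80 * s * t * c * (10 * (m * m))                ≤⟨ *-monoˡ-≤ (10 * (m * m)) long ⟩
        length F * (10 * (m * m))                      ≡⟨ sum-const (length F) (10 * (m * m)) ⟨
        sum {length F} (λ i → 10 * (m * m))            ≤⟨ sum-mono many ⟩
        sum (λ i → 48 * s * totalHits (lookup F i))    ≡⟨ *-distribˡ-sum (48 * s) (λ i → totalHits (lookup F i)) ⟨
        48 * s * sum (λ i → totalHits (lookup F i))    ≤⟨ *-monoʳ-≤ (48 * s) sum-totalHits ⟩
        -- As t ≥ 1, 4 + t ≤ 5t; hence 240 = 48 · 5.
        48 * s * (m * (m * ((4 + t) * c)))             ≤⟨ *-monoʳ-≤ (48 * s) (*-monoʳ-≤ m (*-monoʳ-≤ m (*-monoˡ-≤ c (+-monoˡ-≤ t (m≤m*n 4 t))))) ⟩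
        48 * s * (m * (m * ((4 * t + t) * c)))         ≡⟨ e₂ s t c m ⟩
        240 * X                                        ∎)
        where
        open ≤-Reasoning
        X = s * t * c * (m * m)

        instance
          m≢0 : NonZero m
          m≢0 = >-nonZero (≤-<-trans z≤n (toℕ<n (proj₁ (enum-surjective (proj₂ C-nonempty)))))

        X≢0 : NonZero X
        X≢0 = m*n≢0 (s * t * c) (m * m) {{m*n≢0 (s * t) c {{m*n≢0 s t}}}} {{m*n≢0 m m}}

        e₁ : ∀ s t c m → 800 * (s * t * c * (m * m)) ≡ 80 * s * t * c * (10 * (m * m))
        e₁ = solve-∀
        e₂ : ∀ s t c m → 48 * s * (m * (m * ((4 * t + t) * c))) ≡ 240 * (s * t * c * (m * m))
        e₂ = solve-∀

lemma4p11 : ∀ {n} (G : Graph (Fin n)) (V′ : Subset n) → Nonempty V′ →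
    ∀ (s t c : ℕ) → .{{_ : NonZero s}} → .{{_ : NonZero t}} → .{{_ : NonZero c}} →
    (F : List (Subset n)) →
    All (IsBoostedSeparator G V′ s) F →
    length F ≥ 80 * s * t * c →
    (∀ v → v ∈ V′ → occurrences v F ≤ c) →
    S t IsInducedIn G
lemma4p11 G V′ _ s t c [] _ long _ =
  contradiction long (<⇒≱ (>-nonZero⁻¹ (80 * s * t * c)
    {{m*n≢0 (80 * s * t) c {{m*n≢0 (80 * s) t {{m*n≢0 80 s}}}}}}))
-- The first separator supplies the largest component C used for all of them.
lemma4p11 G V′ _ s t c F@(_ ∷ _) seps@((_ , sep) ∷ _) long bounded =
  [ id , (λ many → contradiction many (¬manyHits G C-largest t F bounded long)) ]′
    (sequence-⊎ λ i → claw⊎manyHits G C-largest t (All.lookup seps (∈-lookup i)))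
  where open IsBoostedSeparatorWithCore sep
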